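{- Let $n,k\ge 1$. For any $k$-tensor $T$ on $\mathbb{R}^n$, any real $n\times n$ matrices $H_1,\dots,H_k$, and any permutation $\sigma$ on $\mathbb{N}_k$ we have the identity $$\langle T, H_1\circ_\sigma \cdots\circ_\sigma H_k\rangle = (\mathrm{Diag}^{\sigma}\,T)[H_1,\dots,H_k].$$
   Context: $\mathbb{N}_k=\{1,\dots,k\}$. A $k$-tensor $T$ on $\mathbb{R}^n$ is a multilinear real map on $(\mathbb{R}^n)^k$, identified (standard basis) with an array of real entries $T^{i_1\dots i_k}$, $1\le i_s\le n$. Scalar product: $\langle T_1,T_2\rangle=\sum_{i_1,\dots,i_k=1}^n T_1^{i_1\dots i_k}T_2^{i_1\dots i_k}$. $H^{ij}$ denotes the $(i,j)$ entry of a matrix $H$. $\sigma$-Hadamard product: let $H_{pq}$ be the matrix with $1$ in position $(p,q)$ and $0$ elsewhere. For a permutation $\sigma$ on $\mathbb{N}_k$, $(H_{p_1q_1}\circ_\sigma\cdots\circ_\sigma H_{p_kq_k})^{i_1\dots i_k}=1$ if $i_s=p_s=q_{\sigma(s)}$ for all $s=1,\dots,k$, and $0$ otherwise; the product is extended to a $k$-tensor valued map of $k$ matrix arguments, linear in each argument separately. $\mathrm{Diag}^{\sigma}T$ is the $2k$-tensor with entries, indexed by pairs of multi-indices $(i_1\dots i_k;\,j_1\dots j_k)$, equal to $T^{i_1\dots i_k}$ if $i_s=j_{\sigma(s)}$ for all $s=1,\dots,k$, and $0$ otherwise. A $2k$-tensor $S$ is evaluated at $k$ matrices by $S[H_1,\dots,H_k]=\sum_{p_1,q_1,\dots,p_k,q_k=1}^n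 S^{p_1\dots p_k;\,q_1\dots q_k}H_1^{p_1q_1}\cdots H_k^{p_kq_k}$. -}

module Defs where

open import Algebra.Bundles using (CommutativeRing)
open import Data.Bool.Base using (if_then_else_)
open import Data.Fin.Base using (Fin; zero; suc)
open import Data.Fin.Permutation using (Permutation′; _⟨$⟩ʳ_)
open import Data.Fin.Properties using (_≟_; all?)
open import Data.Nat.Base using (ℕ; zero; suc)
open import Data.Product.Base using (_×_; _,_; proj₁; proj₂; ∃)
open import Data.Vec.Base using (Vec; []; _∷_; lookup)
open import Data.Vec.Functional using (Vector; updateAt)
open import Function.Base using (const; _∘_)
open import Relation.Binary.PropositionalEquality.Core as ≡ using (_≡_; _≢_)
open import Relation.Nullary.Decidable using (does; yes; no; _×-dec_; dec-true; dec-false)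
open import Relation.Nullary.Negation using (¬_; contradiction)

MultiIndex : ℕ → ℕ → Set
MultiIndex n k = Vec (Fin n) k

-- The scalars are an arbitrary commutative ring R, of which ℝ is an instance.
module Tensors {c ℓ} (R : CommutativeRing c ℓ) where

  open CommutativeRing R hiding (zero)
  open import Algebra.Properties.Semiring.Sum semiring
  open import Algebra.Definitions.RawMonoid *-rawMonoid using () renaming (sum to product)

  Matrix : ℕ → Set c
  Matrix n = Fin n → Fin n → Carrier

  Tensor : ℕ → ℕ → Set c
  Tensor n k = MultiIndex n k → Carrier

  -- 2k-tensors, with the 2k indices written as a pair (i₁ … iₖ ; j₁ … jₖ).
  PairTensor : ℕ → ℕ → Set c
  PairTensor n k = MultiIndex n k → MultiIndex n k → Carrier

  sumIdx : ∀ {n k} → (MultiIndex n k → Carrier) → Carrier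
  sumIdx {n} {zero}  f = f []
  sumIdx {n} {suc k} f = ∑[ i < n ] sumIdx (λ is → f (i ∷ is))

  infix 10 ⟨_,_⟩
  ⟨_,_⟩ : ∀ {n k} → Tensor n k → Tensor n k → Carrier
  ⟨ T₁ , T₂ ⟩ = sumIdx λ i → T₁ i * T₂ i

  _[_] : ∀ {n k} → PairTensor n k → Vector (Matrix n) k → Carrier
  S [ H ] = sumIdx λ p → sumIdx λ q →
    S p q * product (λ s → H s (lookup p s) (lookup q s))

  Diag : ∀ {n k} → Permutation′ k → Tensor n k → PairTensor n k
  Diag σ T i j =
    if does (all? λ s → lookup i s ≟ lookup j (σ ⟨$⟩ʳ s))
    then T i else 0#

  -- H_{p₁q₁} ∘_σ … ∘_σ H_{pₖqₖ}, for the matrix units H_{pq}.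
  unitHadamard : ∀ {n k} → Permutation′ k → MultiIndex n k → MultiIndex n k → Tensor n k
  unitHadamard σ p q i =
    if does (all? λ s → (lookup i s ≟ lookup p s) ×-dec (lookup p s ≟ lookup q (σ ⟨$⟩ʳ s)))
    then 1# else 0#

  -- H₁ ∘_σ … ∘_σ Hₖ: substitute Hₛ = ∑ Hₛ^{pq} H_{pq} in every slot and expand by
  -- linearity. `hadamard-unit` and `hadamard-linear` below show that this does
  -- extend `unitHadamard` to a map linear in each argument separately.
  hadamard : ∀ {n k} → Permutation′ k → Vector (Matrix n) k → Tensor n k
  hadamard σ H i = sumIdx λ p → sumIdx λ q →
    product (λ s → H s (lookup p s) (lookup q s)) * unitHadamard σ p q i

  unit : ∀ {n} → Fin n → Fin n → Matrix n
  unit p q a b = if does ((p ≟ a) ×-dec (q ≟ b)) then 1# else 0#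

  open import Relation.Binary.Reasoning.Setoid setoid

  sumIdx-cong : ∀ {n k} {f g : MultiIndex n k → Carrier} →
                (∀ i → f i ≈ g i) → sumIdx f ≈ sumIdx g
  sumIdx-cong {k = zero}  eq = eq []
  sumIdx-cong {k = suc k} eq = sum-cong-≋ λ i → sumIdx-cong λ is → eq (i ∷ is)

  sum-0 : ∀ {n} {f : Vector Carrier n} → (∀ i → f i ≈ 0#) → sum f ≈ 0#
  sum-0 {n} eq = trans (sum-cong-≋ eq) (sum-replicate-zero n)

  sumIdx-0 : ∀ {n k} {f : MultiIndex n k → Carrier} → (∀ i → f i ≈ 0#) → sumIdx f ≈ 0#
  sumIdx-0 {k = zero}  eq = eq []
  sumIdx-0 {k = suc k} eq = sum-0 λ i → sumIdx-0 λ is → eq (i ∷ is)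

  sum-single : ∀ {n} (f : Vector Carrier n) j → (∀ i → i ≢ j → f i ≈ 0#) → sum f ≈ f j
  sum-single f zero    eq = trans (+-congˡ (sum-0 λ i → eq (suc i) λ ())) (+-identityʳ _)
  sum-single f (suc j) eq = trans
    (+-cong (eq zero λ ()) (sum-single (f ∘ suc) j λ i i≢j → eq (suc i) λ { ≡.refl → i≢j ≡.refl }))
    (+-identityˡ _)

  sumIdx-single : ∀ {n k} (f : MultiIndex n k → Carrier) j →
                  (∀ i → i ≢ j → f i ≈ 0#) → sumIdx f ≈ f j
  sumIdx-single f []       eq = refl
  sumIdx-single f (j ∷ js) eq = trans
    (sum-single _ j λ i i≢j → sumIdx-0 λ is → eq (i ∷ is) λ { ≡.refl → i≢j ≡.refl })
    (sumIdx-single (λ is → f (j ∷ is)) js λ is is≢js → eq (j ∷ is) λ { ≡.refl → is≢js ≡.refl })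

  sum-lin : ∀ {n} a b (f g : Vector Carrier n) →
            ∑[ i < n ] (a * f i + b * g i) ≈ a * sum f + b * sum g
  sum-lin a b f g = trans (∑-distrib-+ (λ i → a * f i) (λ i → b * g i))
    (sym (+-cong (*-distribˡ-sum a f) (*-distribˡ-sum b g)))

  sumIdx-lin : ∀ {n k} a b (f g : MultiIndex n k → Carrier) →
               sumIdx (λ i → a * f i + b * g i) ≈ a * sumIdx f + b * sumIdx g
  sumIdx-lin {k = zero}  a b f g = refl
  sumIdx-lin {n} {suc k} a b f g = trans
    (sum-cong-≋ λ i → sumIdx-lin a b (λ is → f (i ∷ is)) (λ is → g (i ∷ is)))
    (sum-lin {n} a b (λ i → sumIdx λ is → f (i ∷ is)) (λ i → sumIdx λ is → g (i ∷ is)))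

  lookup-≢ : ∀ {n k} (i j : MultiIndex n k) → i ≢ j → ∃ λ s → lookup j s ≢ lookup i s
  lookup-≢ []       []       i≢j = contradiction ≡.refl i≢j
  lookup-≢ (i ∷ is) (j ∷ js) i≢j with j ≟ i
  ... | no  j≢i    = zero , j≢i
  ... | yes ≡.refl with lookup-≢ is js (λ { ≡.refl → i≢j ≡.refl })
  ...   | s , ne   = suc s , ne

  product-0 : ∀ {k} (f : Vector Carrier k) s → f s ≈ 0# → product f ≈ 0#
  product-0 f zero    eq = trans (*-congʳ eq) (zeroˡ _)
  product-0 f (suc s) eq = trans (*-congˡ (product-0 (f ∘ suc) s eq)) (zeroʳ _)

  product-1 : ∀ {k} (f : Vector Carrier k) → (∀ s → f s ≈ 1#) → product f ≈ 1#
  product-1 {zero}  f eq = refl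
  product-1 {suc k} f eq = trans (*-cong (eq zero) (product-1 (f ∘ suc) (eq ∘ suc))) (*-identityˡ _)

  pull : ∀ x a b y z → x * (a * y + b * z) ≈ a * (x * y) + b * (x * z)
  pull x a b y z = trans (distribˡ x _ _) (+-cong (swap a y) (swap b z))
    where
    swap : ∀ a y → x * (a * y) ≈ a * (x * y)
    swap a y = trans (sym (*-assoc x a y)) (trans (*-congʳ (*-comm x a)) (*-assoc a x y))

  product-lin : ∀ {k m} {M : Set m} (φ : Fin k → M → Carrier) (H : Vector M k) s a b A B C →
                φ s C ≈ a * φ s A + b * φ s B →
                product (λ t → φ t (updateAt H s (const C) t)) ≈
                a * product (λ t → φ t (updateAt H s (const A) t)) +
                b * product (λ t → φ t (updateAt H s (const B) t))
  product-lin {suc k} φ H zero    a b A B C eq = trans (*-congʳ eq)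
    (trans (distribʳ _ _ _) (+-cong (*-assoc a _ _) (*-assoc b _ _)))
  product-lin {suc k} φ H (suc s) a b A B C eq = trans
    (*-congˡ (product-lin (φ ∘ suc) (H ∘ suc) s a b A B C eq)) (pull _ a b _ _)

  unit-0 : ∀ {n} (p q a b : Fin n) → ¬ (p ≡ a × q ≡ b) → unit p q a b ≈ 0#
  unit-0 p q a b ne
    rewrite dec-false ((p ≟ a) ×-dec (q ≟ b)) ne = refl

  unit-1 : ∀ {n} (p q : Fin n) → unit p q p q ≈ 1#
  unit-1 p q rewrite dec-true ((p ≟ p) ×-dec (q ≟ q)) (≡.refl , ≡.refl) = refl

  hadamard-unit : ∀ {n k} (σ : Permutation′ k) (p q i : MultiIndex n k) →
                  hadamard σ (λ s → unit (lookup p s) (lookup q s)) i ≈ unitHadamard σ p q i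
  hadamard-unit {n} {k} σ p q i = begin
    hadamard σ (λ s → unit (lookup p s) (lookup q s)) i
      ≈⟨ sumIdx-single _ p (λ p′ p′≢p → sumIdx-0 {n} {k} λ q′ →
           let s , ne = lookup-≢ p′ p p′≢p in
           trans (*-congʳ (product-0 _ s (unit-0 (lookup p s) (lookup q s) (lookup p′ s) (lookup q′ s) (ne ∘ proj₁)))) (zeroˡ _)) ⟩
    sumIdx (λ q′ → product (λ s → unit (lookup p s) (lookup q s) (lookup p s) (lookup q′ s))
                   * unitHadamard σ p q′ i)
      ≈⟨ sumIdx-single _ q (λ q′ q′≢q →
           let s , ne = lookup-≢ q′ q q′≢q in
           trans (*-congʳ (product-0 _ s (unit-0 (lookup p s) (lookup q s) (lookup p s) (lookup q′ s) (ne ∘ proj₂)))) (zeroˡ _)) ⟩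
    product (λ s → unit (lookup p s) (lookup q s) (lookup p s) (lookup q s)) * unitHadamard σ p q i
      ≈⟨ *-congʳ (product-1 _ λ s → unit-1 (lookup p s) (lookup q s)) ⟩
    1# * unitHadamard σ p q i
      ≈⟨ *-identityˡ _ ⟩
    unitHadamard σ p q i ∎

  hadamard-linear : ∀ {n k} (σ : Permutation′ k) (H : Vector (Matrix n) k) (s : Fin k)
                    (a b : Carrier) (A B : Matrix n) (i : MultiIndex n k) →
                    hadamard σ (updateAt H s (const λ p q → a * A p q + b * B p q)) i ≈
                    a * hadamard σ (updateAt H s (const A)) i +
                    b * hadamard σ (updateAt H s (const B)) i
  hadamard-linear {n} {k} σ H s a b A B i = trans
    (sumIdx-cong λ p → trans
      (sumIdx-cong λ q → trans (*-comm _ _) (trans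
        (*-congˡ (product-lin (λ t M → M (lookup p t) (lookup q t)) H s a b A B _ refl))
        (trans (pull _ a b _ _) (+-cong (*-congˡ (*-comm _ _)) (*-congˡ (*-comm _ _))))))
      (sumIdx-lin a b (summand A p) (summand B p)))
    (sumIdx-lin a b (λ p → sumIdx (summand A p)) (λ p → sumIdx (summand B p)))
    where
    summand : Matrix n → MultiIndex n k → MultiIndex n k → Carrier
    summand X p q = product (λ t → updateAt H s (const X) t (lookup p t) (lookup q t))
                    * unitHadamard σ p q i

-- The matrix-unit product vanishes at i unless p = i, so in ∑_p ∑_q only p = i survives in the
-- i-entry of H₁ ∘_σ … ∘_σ Hₖ; the remaining factor [ iₛ = q_{σ(s)} for all s ] times Tⁱ is the
-- (i ; q)-entry of Diag^σ T. Both sides then agree term by term in i and q.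
module Submission where

open import Defs
open import Algebra.Bundles using (CommutativeRing)
open import Data.Nat.Base using (ℕ; NonZero; zero; suc)
open import Data.Fin.Permutation using (Permutation′; _⟨$⟩ʳ_)
open import Data.Fin.Properties using (_≟_; all?)
open import Data.Product.Base using (_,_; proj₁; proj₂)
open import Data.Vec.Base using ([]; _∷_; lookup)
open import Data.Vec.Functional using (Vector)
open import Function.Base using (_∘_)
open import Relation.Binary.PropositionalEquality.Core as ≡ using (_≡_; _≢_)
open import Relation.Nullary.Decidable using (Dec; yes; no; _×-dec_; dec-true; dec-false)

module _ {c ℓ} (R : CommutativeRing c ℓ) where
  open CommutativeRing R hiding (zero)
  open Tensors R
  open import Algebra.Properties.Semiring.Sum semiring using (*-distribˡ-sum; sum-cong-≋)
  open import Algebra.Definitions.RawMonoid *-rawMonoid using () renaming (sum to product)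
  open import Relation.Binary.Reasoning.Setoid setoid

  *-distribˡ-sumIdx : ∀ {n k} a (f : MultiIndex n k → Carrier) →
                      a * sumIdx f ≈ sumIdx (λ i → a * f i)
  *-distribˡ-sumIdx {k = zero}      a f = refl
  *-distribˡ-sumIdx {n} {k = suc k} a f = trans
    (*-distribˡ-sum {n} a (λ i → sumIdx (f ∘ (i ∷_))))
    (sum-cong-≋ {n} λ i → *-distribˡ-sumIdx a (f ∘ (i ∷_)))

  -- Distinct multi-indices differ in some slot `s`, and there the first half of the test,
  -- `lookup i s ≡ lookup p s`, fails.
  unitHadamard-≢ : ∀ {n k} (σ : Permutation′ k) (p q i : MultiIndex n k) →
                   p ≢ i → unitHadamard σ p q i ≈ 0#
  unitHadamard-≢ σ p q i p≢i
    rewrite dec-false (all? λ s → (lookup i s ≟ lookup p s) ×-dec (lookup p s ≟ lookup q (σ ⟨$⟩ʳ s)))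
      (λ eq → let s , ne = lookup-≢ p i p≢i in ne (proj₁ (eq s)))
    = refl

  -- On the diagonal `p = i` the first half of each slot's test is reflexive, so the test of
  -- `unitHadamard` is equivalent to that of `Diag`.
  *-unitHadamard : ∀ {n k} (σ : Permutation′ k) (T : Tensor n k) (i q : MultiIndex n k) →
                   T i * unitHadamard σ i q i ≈ Diag σ T i q
  -- The two tests are equivalent but are different terms, so one decision is split on and both
  -- truth values are derived from it.
  *-unitHadamard σ T i q = go (all? λ s → lookup i s ≟ lookup q (σ ⟨$⟩ʳ s))
    where
    go : Dec (∀ s → lookup i s ≡ lookup q (σ ⟨$⟩ʳ s)) → T i * unitHadamard σ i q i ≈ Diag σ T i q
    go (yes eq)
      rewrite dec-true (all? λ s → (lookup i s ≟ lookup i s) ×-dec (lookup i s ≟ lookup q (σ ⟨$⟩ʳ s)))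
                (λ s → ≡.refl , eq s)
            | dec-true (all? λ s → lookup i s ≟ lookup q (σ ⟨$⟩ʳ s)) eq
      = *-identityʳ _
    go (no ne)
      rewrite dec-false (all? λ s → (lookup i s ≟ lookup i s) ×-dec (lookup i s ≟ lookup q (σ ⟨$⟩ʳ s)))
                (λ eq → ne (proj₂ ∘ eq))
            | dec-false (all? λ s → lookup i s ≟ lookup q (σ ⟨$⟩ʳ s)) ne
      = zeroʳ _

  -- The theorem before summation over `i`: the right-hand side is the inner sum of `Diag σ T [ H ]`
  -- with first multi-index `i`.
  *-hadamard : ∀ {n k} (σ : Permutation′ k) (T : Tensor n k) (H : Vector (Matrix n) k)
               (i : MultiIndex n k) →
               T i * hadamard σ H i ≈
               sumIdx λ q → Diag σ T i q * product (λ s → H s (lookup i s) (lookup q s))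
  *-hadamard {n} {k} σ T H i = begin
    T i * hadamard σ H i
      -- The sum over `p` collapses to `p = i`: for any other `p` every term of the inner sum over
      -- `q` is zero.
      ≈⟨ *-congˡ (sumIdx-single _ i λ p p≢i → sumIdx-0 {n} {k} λ q →
           trans (*-congˡ (unitHadamard-≢ σ p q i p≢i)) (zeroʳ _)) ⟩
    T i * sumIdx (λ q → Π q * unitHadamard σ i q i)
      ≈⟨ *-distribˡ-sumIdx {n} {k} (T i) _ ⟩
    sumIdx (λ q → T i * (Π q * unitHadamard σ i q i))
      -- Commutativity moves `Π q` to the right, so that `T i` meets `unitHadamard σ i q i` and the
      -- two merge into a `Diag` entry.
      ≈⟨ sumIdx-cong (λ q → trans (*-congˡ (*-comm _ _))
           (trans (sym (*-assoc _ _ _)) (*-congʳ (*-unitHadamard σ T i q)))) ⟩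
    sumIdx (λ q → Diag σ T i q * Π q) ∎
    where
    Π : MultiIndex n k → Carrier
    Π q = product (λ s → H s (lookup i s) (lookup q s))

corollary4p5 : ∀ {c ℓ} (R : CommutativeRing c ℓ) →
    let open CommutativeRing R using (_≈_)
        open Tensors R
    in (n k : ℕ) .{{_ : NonZero n}} .{{_ : NonZero k}}
       (T : Tensor n k) (H : Vector (Matrix n) k) (σ : Permutation′ k) →
       ⟨ T , hadamard σ H ⟩ ≈ Diag σ T [ H ]
-- Both sides unfold to an outer `sumIdx` over the same multi-index, so entrywise equality suffices.
corollary4p5 R n k T H σ = Tensors.sumIdx-cong R (*-hadamard R σ T H)
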